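{- For every $n\in\mathbb{N}$ (i.e. every positive integer $n$), $W_{c}(K_{2n+1})\geq 3n$.
   Context: $K_{m}$ is the complete graph on $m$ vertices. For a finite simple graph $G$ and a positive integer $t$, an interval cyclic $t$-coloring of $G$ is a proper edge-coloring of $G$ with colors $1,\ldots,t$ such that all $t$ colors are used and, for each vertex $v$, the edges incident to $v$ are colored by $d_{G}(v)$ consecutive colors modulo $t$ (i.e. consecutive in the cyclic order $1,2,\ldots,t,1$), where $d_G(v)$ is the degree of $v$. For a graph $G$ having an interval cyclic $t$-coloring for some positive integer $t$, $W_{c}(G)$ is the greatest such $t$. (All complete graphs $K_{2n+1}$, $n\ge 1$, have such a coloring.) -}

module Defs where

open import Data.Fin.Base using (Fin; toℕ)
open import Data.Fin.Properties using (_≟_)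
open import Data.List.Base using (allFin; filter; length)
open import Data.Nat.Base using (ℕ; NonZero; _+_; _<_; _≤_)
open import Data.Nat.DivMod using (_%_)
open import Data.Product.Base using (∃-syntax; _×_)
open import Function.Bundles using (_⇔_)
open import Relation.Binary.Core using (Rel)
open import Relation.Binary.Definitions using (Decidable; Irreflexive; Symmetric)
open import Relation.Binary.PropositionalEquality
  using (_≡_; _≢_; ≢-sym)
open import Relation.Nullary.Decidable using (¬?)
open import Relation.Unary using (Pred)
open import Level using (0ℓ)

record FiniteSimpleGraph : Set₁ where
  infix 4 _~_ _~?_
  field
    order    : ℕ
    _~_      : Rel (Fin order) 0ℓ
    _~?_     : Decidable _~_
    ~-sym    : Symmetric _~_
    ~-irrefl : Irreflexive _≡_ _~_

  Vertex : Set
  Vertex = Fin order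

  degree : Vertex → ℕ
  degree v = length (filter (v ~?_) (allFin order))

complete : ℕ → FiniteSimpleGraph
complete m = record
  { order    = m
  ; _~_      = _≢_
  ; _~?_     = λ u v → ¬? (u ≟ v)
  ; ~-sym    = ≢-sym
  ; ~-irrefl = λ u≡v u≢v → u≢v u≡v
  }

-- The colors 1, …, t are represented by the elements 0, …, t - 1 of Fin t.
record IntervalCyclicColoring (G : FiniteSimpleGraph) (t : ℕ) : Set where
  open FiniteSimpleGraph G
  field
    {{positive}} : NonZero t
    color        : ∀ {u v} → u ~ v → Fin t

    -- The color depends only on the unordered pair {u, v}, and in particular
    -- not on the adjacency proof: color e ≡ color (~-sym e) ≡ color e′
    -- whenever e, e′ : u ~ v.
    color-sym    : ∀ {u v} (e : u ~ v) (e′ : v ~ u) → color e ≡ color e′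

  -- The color k occurs on an edge incident to v.
  Occurs : Vertex → Fin t → Set
  Occurs v k = ∃[ w ] ∃[ e ] color {v} {w} e ≡ k

  field
    proper      : ∀ {u v w} (e : u ~ v) (e′ : u ~ w) → color e ≡ color e′ → v ≡ w
    all-used    : ∀ k → ∃[ v ] Occurs v k
    consecutive : ∀ v → ∃[ s ] ∀ k →
                  Occurs v k ⇔ (∃[ i ] (i < degree v × toℕ k ≡ (toℕ {t} s + i) % t))

IsGreatest : Pred ℕ 0ℓ → ℕ → Set
IsGreatest P m = P m × (∀ k → P k → k ≤ m)

-- W_c is a partial function of the graph, so it is given by its graph
-- as a relation: IsWc G w says that W_c(G) is defined and equal to w.
IsWc : FiniteSimpleGraph → ℕ → Set
IsWc G = IsGreatest (IntervalCyclicColoring G)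

{-# OPTIONS --safe #-}
module Submission where

-- Two facts give the theorem.
--
-- First, W_c(G) exists, and is at least t, as soon as G has an interval cyclic
-- t-coloring (Wc-exists).  The number of colors is bounded by the number of
-- ordered pairs of vertices (coloring-bound), and a coloring with a given number
-- of colors amounts to a matrix with finitely many candidates, so that its
-- existence is decidable (coloring?) and the greatest number of colors can be
-- found by descending from the bound.
--
-- Second, the complete graph on 2n + 1 vertices has an interval cyclic
-- 3n-coloring (odd-coloring).  Call the vertices lower i and upper i, for
-- 0 ≤ i < n, and apex.  Let f(s) = s + 1 if s < n and f(s) = s + n if s ≥ n.
-- With colors read modulo 3n, the edges are colored as follows:
--
--   lower i -- lower j,  upper i -- upper j   (i ≠ j)   f(i + j)
--   lower i -- upper i                                  f(i + i)
--   lower i -- upper j                        (i ≠ j)   n + ((j - i) mod n)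
--   lower i -- apex                                     i
--   upper i -- apex                                     2n + i
--
-- For fixed i and 0 ≤ j < n, the values f(i + j) are i + 1, …, n and
-- 2n, …, 2n + i - 1; the colors n + 1, …, 2n - 1 left out between them are those
-- of the edges joining lower and upper vertices of different index.  Hence
-- lower i and upper i both see i + 1, …, i + 2n - 1, and the edge to the apex
-- adds one more color, i below this arc or i + 2n above it.  The apex sees
-- 2n, …, 3n - 1, 0, …, n - 1.
--
-- Only the occurrence of each color of these arcs has to be checked: a vertex has
-- 2n neighbors and its arc has 2n colors, so properness and the absence of other
-- colors follow by counting (complete-coloring).

open import Defs
open import Data.Nat.Base using (ℕ; _+_; _*_; _≤_)
open import Data.Product.Base using (∃-syntax; _×_)

open import Data.Bool.Base using (if_then_else_)
open import Data.Fin.Base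
  using (Fin; zero; suc; toℕ; fromℕ<; combine; finToFun; funToFin; remQuot; punchOut)
open import Data.Fin.Properties
  using ( _≟_; all?; any?; toℕ<n; toℕ-fromℕ<; toℕ-injective; suc-injective
        ; combine-injective; remQuot-combine; finToFun-funToFin
        ; injective⇒≤; punchOut-injective; +↔⊎; *↔×)
open import Data.List.Base using (filter; length; tabulate)
open import Data.List.Properties using (filter-all; filter-accept; filter-reject; length-tabulate)
open import Data.List.Relation.Unary.All.Properties using (tabulate⁺)
open import Data.Nat.Base
  using (zero; suc; _∸_; _^_; _<_; s≤s⁻¹; z<s; NonZero; >-nonZero; ≢-nonZero⁻¹)
open import Data.Nat.DivMod
  using (_%_; _mod_; m%n<n; m<n⇒m%n≡m; [m+n]%n≡m%n; %-distribˡ-+; m%n%n≡m%n)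
import Data.Nat.Properties as ℕ
open import Data.Nat.Tactic.RingSolver using (solve-∀)
open import Data.Product.Base using (∃; Σ-syntax; _,_; proj₁; proj₂; uncurry)
open import Data.Sum.Base using (_⊎_; inj₁; inj₂)
open import Data.Sum.Function.Propositional using (_⊎-↔_)
open import Function.Base using (_∘_)
open import Function.Bundles using (_⇔_; mk⇔; Equivalence; _↔_; Inverse)
open import Function.Construct.Identity using (↔-id)
open import Function.Construct.Composition using (_↔-∘_; _⇔-∘_)
open import Function.Definitions using (Injective)
open import Relation.Binary.PropositionalEquality
  using (_≡_; _≢_; refl; sym; trans; cong; subst; subst₂; module ≡-Reasoning)
open import Relation.Nullary.Decidable
  using (Dec; yes; no; ¬?; does; dec-true; dec-false; map′; _×-dec_; _→-dec_)
open import Relation.Nullary.Negation using (¬_; contradiction)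
open import Relation.Unary using (Decidable; Pred)
open import Level using (0ℓ)

-- Greatest elements of bounded decidable sets of natural numbers

greatest : {P : Pred ℕ 0ℓ} → Decidable P → ∀ N → (∀ k → P k → k ≤ N) →
           ∀ {m} → P m → ∃[ w ] (IsGreatest P w × m ≤ w)
greatest {P} P? N bound {m} pm with P? N
... | yes pN = N , (pN , bound) , bound m pm
... | no ¬pN with N
...   | zero  = contradiction (subst P (ℕ.n≤0⇒n≡0 (bound m pm)) pm) ¬pN
...   | suc N = greatest P? N
                  (λ k pk → s≤s⁻¹ (ℕ.≤∧≢⇒< (bound k pk) λ { refl → ¬pN pk })) pm

-- Existence of the greatest number of colors

_⇔-dec_ : {A B : Set} → Dec A → Dec B → Dec (A ⇔ B)
a? ⇔-dec b? =
  map′ (uncurry mk⇔) (λ e → Equivalence.to e , Equivalence.from e)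
       ((a? →-dec b?) ×-dec (b? →-dec a?))

module _ (G : FiniteSimpleGraph) where
  open FiniteSimpleGraph G

  module _ {t : ℕ} where

    -- The color depends on the edge only, not on the proof of adjacency: both
    -- sides are compared with the reversed edge.
    color-irr : (C : IntervalCyclicColoring G t) → let open IntervalCyclicColoring C in
                ∀ {u v} (e e′ : u ~ v) → color e ≡ color e′
    color-irr C e e′ = trans (color-sym e (~-sym e)) (sym (color-sym e′ (~-sym e)))
      where open IntervalCyclicColoring C

    -- Choosing for each color an edge that carries it, with an orientation, embeds
    -- the colors into the ordered pairs of vertices.
    coloring-bound : IntervalCyclicColoring G t → t ≤ order * order
    coloring-bound C = injective⇒≤ {f = end} end-injective
      where
      open IntervalCyclicColoring C
      end : Fin t → Fin (order * order)
      end k = let v , w , _ = all-used k in combine v w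
      end-injective : Injective _≡_ _≡_ end
      end-injective {k} {l} eq with all-used k | all-used l
      ... | v , w , e , refl | v′ , w′ , e′ , refl
          with refl , refl ← combine-injective v w v′ w′ eq = color-irr C e e′

    module _ {{_ : NonZero t}} where

      -- A square matrix of colors indexed by the vertices, encoded as an element of
      -- a finite type so that it can be searched for.
      Code : Set
      Code = Fin (t ^ (order * order))

      entry : Code → Vertex → Vertex → Fin t
      entry M u v = finToFun M (combine u v)

      -- The color k stands in row v of the matrix, in the column of a neighbor of v.
      Sees : Code → Vertex → Fin t → Set
      Sees M v k = ∃[ w ] (v ~ w × entry M v w ≡ k)

      -- The color k is one of the degree v consecutive colors that begin with s.
      Arc : Vertex → Fin t → Fin t → Set
      Arc v s k = ∃[ i ] (i < degree v × toℕ k ≡ (toℕ s + i) % t)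

      -- The matrix defines an interval cyclic coloring; its entries at pairs of
      -- nonadjacent vertices are irrelevant.
      Valid : Code → Set
      Valid M = (∀ u v → u ~ v → entry M u v ≡ entry M v u)
              × (∀ u v w → u ~ v → u ~ w → entry M u v ≡ entry M u w → v ≡ w)
              × (∀ k → ∃[ v ] Sees M v k)
              × (∀ v → ∃[ s ] ∀ k → Sees M v k ⇔ Arc v s k)

      valid? : Decidable Valid
      valid? M =
        all? (λ u → all? λ v → (u ~? v) →-dec (entry M u v ≟ entry M v u))
        ×-dec
        all? (λ u → all? λ v → all? λ w →
          (u ~? v) →-dec ((u ~? w) →-dec ((entry M u v ≟ entry M u w) →-dec (v ≟ w))))
        ×-dec
        all? (λ k → any? λ v → sees? v k)
        ×-dec
        all? (λ v → any? λ s → all? λ k →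
          sees? v k ⇔-dec ℕ.anyUpTo? (λ i → toℕ k ℕ.≟ (toℕ s + i) % t) (degree v))
        where
        sees? : ∀ v k → Dec (Sees M v k)
        sees? v k = any? λ w → (v ~? w) ×-dec (entry M v w ≟ k)

      decode : ∃ Valid → IntervalCyclicColoring G t
      decode (M , symm , prop , used , consec) = record
        { color       = λ {u} {v} _ → entry M u v
        ; color-sym   = λ {u} {v} e _ → symm u v e
        ; proper      = λ {u} {v} {w} → prop u v w
        ; all-used    = used
        ; consecutive = consec
        }

    encode : (C : IntervalCyclicColoring G t) →
             ∃ (Valid {{IntervalCyclicColoring.positive C}})
    encode C = M , symm , prop , used , consec
      where
      open IntervalCyclicColoring C

      -- An arbitrary color is entered at nonadjacent pairs.
      colorOf : Vertex → Vertex → Fin t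
      colorOf u v with u ~? v
      ... | yes e = color e
      ... | no  _ = 0 mod t

      colorOf≡color : ∀ {u v} (e : u ~ v) → colorOf u v ≡ color e
      colorOf≡color {u} {v} e with u ~? v
      ... | yes e′ = color-irr C e′ e
      ... | no  ¬e = contradiction e ¬e

      M : Code
      M = funToFin (λ p → uncurry colorOf (remQuot order p))

      entry≡color : ∀ {u v} (e : u ~ v) → entry M u v ≡ color e
      entry≡color {u} {v} e = begin
        entry M u v                                    ≡⟨ finToFun-funToFin _ (combine u v) ⟩
        uncurry colorOf (remQuot order (combine u v))  ≡⟨ cong (uncurry colorOf) (remQuot-combine u v) ⟩
        colorOf u v                                    ≡⟨ colorOf≡color e ⟩
        color e                                        ∎
        where open ≡-Reasoning

      symm : ∀ u v → u ~ v → entry M u v ≡ entry M v u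
      symm u v e = trans (entry≡color e)
                     (trans (color-sym e (~-sym e)) (sym (entry≡color (~-sym e))))

      prop : ∀ u v w → u ~ v → u ~ w → entry M u v ≡ entry M u w → v ≡ w
      prop u v w e e′ eq = proper e e′ (trans (sym (entry≡color e)) (trans eq (entry≡color e′)))

      occurs⇔sees : ∀ v k → Sees M v k ⇔ Occurs v k
      occurs⇔sees v k = mk⇔
        (λ (w , e , eq) → w , e , trans (sym (entry≡color e)) eq)
        (λ (w , e , eq) → w , e , trans (entry≡color e) eq)

      used : ∀ k → ∃[ v ] Sees M v k
      used k = let v , o = all-used k in v , Equivalence.from (occurs⇔sees v k) o

      consec : ∀ v → ∃[ s ] ∀ k → Sees M v k ⇔ Arc v s k
      consec v = let s , eqv = consecutive v in s , λ k → eqv k ⇔-∘ occurs⇔sees v k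

  -- A coloring is a function of adjacency proofs, of which there need not be
  -- finitely many, so the search runs through matrices instead.
  coloring? : Decidable (IntervalCyclicColoring G)
  coloring? zero      = no λ C → contradiction refl (≢-nonZero⁻¹ 0 {{IntervalCyclicColoring.positive C}})
  coloring? t@(suc _) = map′ decode encode (any? valid?)

  Wc-exists : ∀ {t} → IntervalCyclicColoring G t → ∃[ w ] (IsWc G w × t ≤ w)
  Wc-exists = greatest coloring? (order * order) (λ _ → coloring-bound)

-- Colorings of complete graphs by counting

length-filter-except : ∀ {m} {A : Set} {P : Pred A 0ℓ} (P? : Decidable P)
                       (f : Fin m → A) (v : Fin m) → ¬ P (f v) → (∀ w → v ≢ w → P (f w)) →
                       suc (length (filter P? (tabulate f))) ≡ m
length-filter-except P? f zero ¬pv pw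
  rewrite filter-reject P? {x = f zero} {xs = tabulate (f ∘ suc)} ¬pv
        | filter-all P? (tabulate⁺ {f = f ∘ suc} λ w → pw (suc w) λ ())
  = cong suc (length-tabulate (f ∘ suc))
length-filter-except P? f (suc v) ¬pv pw
  rewrite filter-accept P? {x = f zero} {xs = tabulate (f ∘ suc)} (pw zero λ ())
  = cong suc (length-filter-except P? (f ∘ suc) v ¬pv λ w v≢w → pw (suc w) (v≢w ∘ suc-injective))

degree-complete : ∀ {m} (v : Fin m) → suc (FiniteSimpleGraph.degree (complete m) v) ≡ m
degree-complete v =
  length-filter-except (λ w → ¬? (v ≟ w)) (λ w → w) v (λ v≢v → v≢v refl) (λ _ v≢w → v≢w)

-- If y were missed, deleting it from the codomain would leave an injection into a
-- smaller set.
injective⇒surjective : ∀ {m n} {f : Fin m → Fin n} → n ≡ m →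
                       Injective _≡_ _≡_ f → ∀ y → ∃[ x ] f x ≡ y
injective⇒surjective {suc m} {f = f} refl inj y with any? (λ x → f x ≟ y)
... | yes hit  = hit
... | no  miss = contradiction (injective⇒≤ {f = avoid} avoid-injective) ℕ.1+n≰n
  where
  miss′ : ∀ x → y ≢ f x
  miss′ x eq = miss (x , sym eq)
  avoid : Fin (suc m) → Fin m
  avoid x = punchOut (miss′ x)
  avoid-injective : Injective _≡_ _≡_ avoid
  avoid-injective {x} {x′} eq = inj (punchOut-injective (miss′ x) (miss′ x′) eq)

toℕ-mod : ∀ k t {{_ : NonZero t}} → toℕ (k mod t) ≡ k % t
toℕ-mod k t = toℕ-fromℕ< (m%n<n k t)

%-+ˡ : ∀ t {{_ : NonZero t}} a b → (a % t + b) % t ≡ (a + b) % t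
%-+ˡ t a b = begin
  (a % t + b) % t          ≡⟨ %-distribˡ-+ (a % t) b t ⟩
  (a % t % t + b % t) % t  ≡⟨ cong (λ x → (x + b % t) % t) (m%n%n≡m%n a t) ⟩
  (a % t + b % t) % t      ≡⟨ %-distribˡ-+ a b t ⟨
  (a + b) % t              ∎
  where open ≡-Reasoning

-- Adding t ∸ s % t undoes the addition of s modulo t.
%-+-cancelˡ : ∀ {t} {{_ : NonZero t}} s {i j} → i < t → j < t →
              (s + i) % t ≡ (s + j) % t → i ≡ j
%-+-cancelˡ {t} s {i} {j} i<t j<t eq = begin
  i                                  ≡⟨ undo i i<t ⟨
  ((s + i) % t + (t ∸ s % t)) % t    ≡⟨ cong (λ x → (x + (t ∸ s % t)) % t) eq ⟩
  ((s + j) % t + (t ∸ s % t)) % t    ≡⟨ undo j j<t ⟩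
  j                                  ∎
  where
  open ≡-Reasoning
  swap : ∀ a b c → a + (b + c) ≡ b + (a + c)
  swap = solve-∀
  undo : ∀ k → k < t → ((s + k) % t + (t ∸ s % t)) % t ≡ k
  undo k k<t = begin
    ((s + k) % t + (t ∸ s % t)) % t    ≡⟨ %-+ˡ t (s + k) (t ∸ s % t) ⟩
    (s + k + (t ∸ s % t)) % t          ≡⟨ cong (_% t) (ℕ.+-assoc s k _) ⟩
    (s + (k + (t ∸ s % t))) % t        ≡⟨ %-+ˡ t s _ ⟨
    (s % t + (k + (t ∸ s % t))) % t    ≡⟨ cong (_% t) (swap (s % t) k _) ⟩
    (k + (s % t + (t ∸ s % t))) % t    ≡⟨ cong (λ x → (k + x) % t) (ℕ.m+[n∸m]≡n (ℕ.<⇒≤ (m%n<n s t))) ⟩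
    (k + t) % t                        ≡⟨ [m+n]%n≡m%n k t ⟩
    k % t                              ≡⟨ m<n⇒m%n≡m k<t ⟩
    k                                  ∎

-- A coloring of the complete graph on the suc d elements of A.  Colors and arc
-- starts are given by natural numbers, to be read modulo t.  It is enough that
-- every color of the arc of x occurs at x: since x has only d neighbors and the
-- d colors of its arc are distinct, each neighbor is then reached exactly once,
-- so that the coloring is proper and no other color occurs at x.
module _ {m d t : ℕ} {A : Set} (label : Fin m ↔ A) (m≡1+d : m ≡ suc d)
         {{_ : NonZero t}} (d≤t : d ≤ t)
         (c : A → A → ℕ) (c-sym : ∀ x y → c x y ≡ c y x) (start : A → ℕ)
         (hit : ∀ x i → i < d → ∃[ y ] (x ≢ y × c x y % t ≡ (start x + i) % t))
         (cover : ∀ k → k < t → ∃[ x ] ∃[ i ] (i < d × k ≡ (start x + i) % t))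
         where
  open Inverse label using (to; from; strictlyInverseˡ; inverseˡ)
  open ≡-Reasoning

  private
    col : Fin m → Fin m → Fin t
    col u v = c (to u) (to v) mod t

    -- The neighbor of v joined to it by the color number i of its arc.
    neighbor : Fin m → Fin d → Fin m
    neighbor v i = from (proj₁ (hit (to v) (toℕ i) (toℕ<n i)))

    neighbor-≢ : ∀ v i → v ≢ neighbor v i
    neighbor-≢ v i eq = proj₁ (proj₂ (hit (to v) (toℕ i) (toℕ<n i))) (inverseˡ eq)

    neighbor-col : ∀ v i → toℕ (col v (neighbor v i)) ≡ (start (to v) + toℕ i) % t
    neighbor-col v i with y , _ , eq ← hit (to v) (toℕ i) (toℕ<n i) = begin
      toℕ (c (to v) (to (from y)) mod t)  ≡⟨ toℕ-mod _ t ⟩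
      c (to v) (to (from y)) % t          ≡⟨ cong (λ z → c (to v) z % t) (strictlyInverseˡ y) ⟩
      c (to v) y % t                      ≡⟨ eq ⟩
      (start (to v) + toℕ i) % t          ∎

    col-injective : ∀ v i j → col v (neighbor v i) ≡ col v (neighbor v j) → i ≡ j
    col-injective v i j eq =
      toℕ-injective (%-+-cancelˡ (start (to v)) (below i) (below j) (begin
        (start (to v) + toℕ i) % t   ≡⟨ neighbor-col v i ⟨
        toℕ (col v (neighbor v i))   ≡⟨ cong toℕ eq ⟩
        toℕ (col v (neighbor v j))   ≡⟨ neighbor-col v j ⟩
        (start (to v) + toℕ j) % t   ∎))
      where
      below : ∀ (i : Fin d) → toℕ i < t
      below i = ℕ.<-≤-trans (toℕ<n i) d≤t

    -- The d neighbors just found, preceded by v itself: suc d distinct vertices,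
    -- hence all of them.
    closed-neighborhood : Fin m → Fin (suc d) → Fin m
    closed-neighborhood v zero    = v
    closed-neighborhood v (suc i) = neighbor v i

    closed-neighborhood-injective : ∀ v → Injective _≡_ _≡_ (closed-neighborhood v)
    closed-neighborhood-injective v {zero}  {zero}  _  = refl
    closed-neighborhood-injective v {zero}  {suc j} eq = contradiction eq (neighbor-≢ v j)
    closed-neighborhood-injective v {suc i} {zero}  eq = contradiction (sym eq) (neighbor-≢ v i)
    closed-neighborhood-injective v {suc i} {suc j} eq =
      cong suc (col-injective v i j (cong (col v) eq))

    neighbor-surjective : ∀ v w → v ≢ w → ∃[ i ] w ≡ neighbor v i
    neighbor-surjective v w v≢w
      with injective⇒surjective m≡1+d (closed-neighborhood-injective v) w
    ... | zero  , eq = contradiction eq v≢w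
    ... | suc i , eq = i , sym eq

    degree≡d : ∀ v → FiniteSimpleGraph.degree (complete m) v ≡ d
    degree≡d v = ℕ.suc-injective (trans (degree-complete v) m≡1+d)

    start-mod : ∀ v i → (toℕ (start v mod t) + i) % t ≡ (start v + i) % t
    start-mod v i = trans (cong (λ s → (s + i) % t) (toℕ-mod (start v) t)) (%-+ˡ t (start v) i)

    occurs : ∀ v {k} i → i < d → toℕ k ≡ (start (to v) + i) % t →
             ∃[ w ] Σ[ e ∈ v ≢ w ] col v w ≡ k
    occurs v {k} i i<d eq =
      neighbor v j , neighbor-≢ v j , toℕ-injective (begin
        toℕ (col v (neighbor v j))   ≡⟨ neighbor-col v j ⟩
        (start (to v) + toℕ j) % t   ≡⟨ cong (λ i → (start (to v) + i) % t) (toℕ-fromℕ< i<d) ⟩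
        (start (to v) + i) % t       ≡⟨ eq ⟨
        toℕ k                        ∎)
      where j = fromℕ< i<d

    proper : ∀ {u v w} → u ≢ v → u ≢ w → col u v ≡ col u w → v ≡ w
    proper {u} {v} {w} u≢v u≢w eq
      with i , refl ← neighbor-surjective u v u≢v
         | j , refl ← neighbor-surjective u w u≢w = cong (neighbor u) (col-injective u i j eq)

  complete-coloring : IntervalCyclicColoring (complete m) t
  complete-coloring = record
    { color       = λ {u} {v} _ → col u v
    ; color-sym   = λ {u} {v} _ _ → cong (_mod t) (c-sym (to u) (to v))
    ; proper      = proper
    ; all-used    = λ k → let x , i , i<d , eq = cover (toℕ k) (toℕ<n k) in
        from x , occurs (from x) i i<d
          (trans eq (cong (λ y → (start y + i) % t) (sym (strictlyInverseˡ x))))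
    ; consecutive = λ v → start (to v) mod t , λ k → mk⇔
        (λ { (w , v≢w , refl) → let i , w≡ = neighbor-surjective v w v≢w in
             toℕ i , subst (toℕ i <_) (sym (degree≡d v)) (toℕ<n i)
             , trans (cong (toℕ ∘ col v) w≡)
                 (trans (neighbor-col v i) (sym (start-mod (to v) (toℕ i)))) })
        (λ (i , i<deg , eq) → occurs v i (subst (i <_) (degree≡d v) i<deg)
             (trans eq (start-mod (to v) i)))
    }

-- Sums and differences of indices

module _ (n : ℕ) where

  -- The strictly increasing map from 0, …, 2n - 2 to 1, …, 3n - 2 that leaves out
  -- n + 1, …, 2n - 1; it is f in the introduction.
  stretch : ℕ → ℕ
  stretch s = if does (s ℕ.<? n) then suc s else s + n

  stretch-< : ∀ {s} → s < n → stretch s ≡ suc s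
  stretch-< {s} s<n = cong (if_then suc s else s + n) (dec-true (s ℕ.<? n) s<n)

  stretch-≥ : ∀ {s} → n ≤ s → stretch s ≡ s + n
  stretch-≥ {s} n≤s = cong (if_then suc s else s + n) (dec-false (s ℕ.<? n) (ℕ.≤⇒≯ n≤s))

  -- The residue of j - i modulo n, for i and j less than n.
  rotation : ℕ → ℕ → ℕ
  rotation i j = if does (i ℕ.≤? j) then j ∸ i else n + j ∸ i

  rotation-≤ : ∀ {i j} → i ≤ j → rotation i j ≡ j ∸ i
  rotation-≤ {i} {j} i≤j = cong (if_then j ∸ i else n + j ∸ i) (dec-true (i ℕ.≤? j) i≤j)

  rotation-> : ∀ {i j} → j < i → rotation i j ≡ n + j ∸ i
  rotation-> {i} {j} j<i = cong (if_then j ∸ i else n + j ∸ i) (dec-false (i ℕ.≤? j) (ℕ.<⇒≱ j<i))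

  fin : ∀ k → k < n → ∃[ j ] toℕ {n} j ≡ k
  fin k k<n = fromℕ< k<n , toℕ-fromℕ< k<n

  -- A color strictly between i and i + 2n is the value of stretch at a sum i + j,
  -- unless it lies in the gap n + 1, …, 2n - 1.
  stretch-arc : ∀ {i} → i < n → ∀ {r} → suc r < 2 * n →
    (∃[ j ] stretch (i + toℕ {n} j) ≡ suc (i + r)) ⊎
    (∃[ e ] (0 < e × e < n × n + e ≡ suc (i + r)))
  stretch-arc {i} i<n {r} 1+r<2n with i + r ℕ.<? n
  ... | yes i+r<n with j , refl ← fin r (ℕ.≤-<-trans (ℕ.m≤n+m r i) i+r<n) =
          inj₁ (j , stretch-< i+r<n)
  ... | no  i+r≮n with e , n+e≡i+r ← ℕ.m≤n⇒∃[o]m+o≡n (ℕ.≮⇒≥ i+r≮n) | suc e ℕ.<? n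
  ...   | yes 1+e<n = inj₂ (suc e , z<s , 1+e<n , n+1+e≡1+i+r)
    where n+1+e≡1+i+r = trans (ℕ.+-suc n e) (cong suc n+e≡i+r)
  ...   | no  1+e≮n = inj₁ (proj₁ j′ , (begin
            stretch (i + toℕ (proj₁ j′))   ≡⟨ cong (λ j → stretch (i + j)) (proj₂ j′) ⟩
            stretch (i + j)                ≡⟨ stretch-≥ n≤i+j ⟩
            i + j + n                      ≡⟨ i+j+n≡1+i+r ⟩
            suc (i + r)                    ∎))
    where
    open ≡-Reasoning
    2n≤1+i+r : n + n ≤ suc (i + r)
    2n≤1+i+r = subst (n + n ≤_) (trans (ℕ.+-suc n e) (cong suc n+e≡i+r))
                 (ℕ.+-monoʳ-≤ n (ℕ.≮⇒≥ 1+e≮n))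
    n≤1+r : n ≤ suc r
    n≤1+r = ℕ.≮⇒≥ λ 1+r<n → ℕ.<⇒≱ (ℕ.+-mono-< i<n 1+r<n)
              (subst (n + n ≤_) (sym (ℕ.+-suc i r)) 2n≤1+i+r)
    -- The color suc (i + r) is at least 2n, so it must be i + j + n.
    j = suc r ∸ n
    n+j≡1+r : n + j ≡ suc r
    n+j≡1+r = ℕ.m+[n∸m]≡n n≤1+r
    i+j+n≡1+i+r : i + j + n ≡ suc (i + r)
    i+j+n≡1+i+r = begin
      i + j + n     ≡⟨ ℕ.+-assoc i j n ⟩
      i + (j + n)   ≡⟨ cong (i +_) (trans (ℕ.+-comm j n) n+j≡1+r) ⟩
      i + suc r     ≡⟨ ℕ.+-suc i r ⟩
      suc (i + r)   ∎
    n≤i+j : n ≤ i + j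
    n≤i+j = ℕ.+-cancelʳ-≤ n n (i + j) (subst (n + n ≤_) (sym i+j+n≡1+i+r) 2n≤1+i+r)
    j<n : j < n
    j<n = ℕ.+-cancelˡ-< n j n
      (subst₂ _<_ (sym n+j≡1+r) (cong (n +_) (ℕ.+-identityʳ n)) 1+r<2n)
    j′ = fin j j<n

  rotation-unwrapped : ∀ {i j e} → i + e ≡ j → rotation i j ≡ e
  rotation-unwrapped {i} {e = e} refl = trans (rotation-≤ (ℕ.m≤m+n i e)) (ℕ.m+n∸m≡n i e)

  rotation-wrapped : ∀ {i j e} → e < n → i + e ≡ n + j → j < i × rotation i j ≡ e
  rotation-wrapped {i} {j} {e} e<n eq = j<i ,
    trans (rotation-> j<i) (trans (cong (_∸ i) (sym eq)) (ℕ.m+n∸m≡n i e))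
    where
    j<i = ℕ.+-cancelˡ-< n j i (subst₂ _<_ eq (ℕ.+-comm i n) (ℕ.+-monoʳ-< i e<n))

  -- For fixed i, and likewise for fixed j, the residues of j - i run through all
  -- nonzero residues modulo n.
  rotation-target : ∀ i {e} → 0 < e → e < n →
                    ∃[ j ] (i ≢ j × rotation (toℕ {n} i) (toℕ {n} j) ≡ e)
  rotation-target i {e} 0<e e<n with toℕ i + e ℕ.<? n
  ... | yes i+e<n with j , eq ← fin (toℕ i + e) i+e<n =
    j , (λ { refl → ℕ.<⇒≢ (ℕ.m<m+n (toℕ i) 0<e) eq }) , rotation-unwrapped (sym eq)
  ... | no i+e≮n
    with o , n+o≡i+e ← ℕ.m≤n⇒∃[o]m+o≡n (ℕ.≮⇒≥ i+e≮n)
    with o<i , rot ← rotation-wrapped e<n (sym n+o≡i+e)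
    with j , refl ← fin o (ℕ.<-trans o<i (toℕ<n i)) =
    j , (λ { refl → ℕ.<-irrefl refl o<i }) , rot

  rotation-source : ∀ j {e} → 0 < e → e < n →
                    ∃[ i ] (j ≢ i × rotation (toℕ {n} i) (toℕ {n} j) ≡ e)
  rotation-source j {e} 0<e e<n with e ℕ.≤? toℕ j
  ... | yes e≤j with o , e+o≡j ← ℕ.m≤n⇒∃[o]m+o≡n e≤j
    with i , refl ← fin o (ℕ.≤-<-trans (subst (o ≤_) e+o≡j (ℕ.m≤n+m o e)) (toℕ<n j)) =
    i , (λ { refl → ℕ.<⇒≢ (ℕ.m<n+m (toℕ j) 0<e) (sym e+o≡j) })
      , rotation-unwrapped (trans (ℕ.+-comm o e) e+o≡j)
  ... | no e≰j
    with o , e+o≡n+j ← ℕ.m≤n⇒∃[o]m+o≡n (ℕ.≤-trans (ℕ.<⇒≤ e<n) (ℕ.m≤m+n n (toℕ j)))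
    with j<o , rot ← rotation-wrapped e<n (trans (ℕ.+-comm o e) e+o≡n+j)
    with i , refl ← fin o (ℕ.+-cancelʳ-< e o n
           (subst (_< n + e) (trans (sym e+o≡n+j) (ℕ.+-comm e o)) (ℕ.+-monoʳ-< n (ℕ.≰⇒> e≰j)))) =
    i , (λ { refl → ℕ.<-irrefl refl j<o }) , rot

  -- The coloring with 3n colors

  -- The 2n + 1 vertices: two rows of n vertices each, and an apex.
  Point : Set
  Point = (Fin 2 × Fin n) ⊎ Fin 1

  pattern lower i = inj₁ (zero , i)
  pattern upper i = inj₁ (suc zero , i)
  pattern apex    = inj₂ zero

  label : Fin (2 * n + 1) ↔ Point
  label = (*↔× ⊎-↔ ↔-id (Fin 1)) ↔-∘ +↔⊎

  -- The color of the edge from lower i to upper j.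
  across : Fin n → Fin n → ℕ
  across i j = if does (i ≟ j) then stretch (toℕ i + toℕ j) else n + rotation (toℕ i) (toℕ j)

  across-≡ : ∀ i → across i i ≡ stretch (toℕ i + toℕ i)
  across-≡ i = cong (if_then stretch (toℕ i + toℕ i) else n + rotation (toℕ i) (toℕ i))
                 (dec-true (i ≟ i) refl)

  across-≢ : ∀ {i j} → i ≢ j → across i j ≡ n + rotation (toℕ i) (toℕ j)
  across-≢ {i} {j} i≢j =
    cong (if_then stretch (toℕ i + toℕ j) else n + rotation (toℕ i) (toℕ j))
      (dec-false (i ≟ j) i≢j)

  -- The colors, to be read modulo 3n.  The diagonal values do not matter.
  tint : Point → Point → ℕ
  tint (lower i) (lower j) = stretch (toℕ i + toℕ j)
  tint (upper i) (upper j) = stretch (toℕ i + toℕ j)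
  tint (lower i) (upper j) = across i j
  tint (upper i) (lower j) = across j i
  tint (lower i) apex      = toℕ i
  tint apex      (lower i) = toℕ i
  tint (upper i) apex      = 2 * n + toℕ i
  tint apex      (upper i) = 2 * n + toℕ i
  tint apex      apex      = 0

  tint-sym : ∀ x y → tint x y ≡ tint y x
  tint-sym (lower i) (lower j) = cong stretch (ℕ.+-comm (toℕ i) (toℕ j))
  tint-sym (upper i) (upper j) = cong stretch (ℕ.+-comm (toℕ i) (toℕ j))
  tint-sym (lower i) (upper j) = refl
  tint-sym (upper i) (lower j) = refl
  tint-sym (lower i) apex      = refl
  tint-sym apex      (lower i) = refl
  tint-sym (upper i) apex      = refl
  tint-sym apex      (upper i) = refl
  tint-sym apex      apex      = refl

  -- The first of the 2n consecutive colors at a vertex, modulo 3n.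
  arcStart : Point → ℕ
  arcStart (lower i) = toℕ i
  arcStart (upper i) = suc (toℕ i)
  arcStart apex      = 2 * n

  -- Some edge at x has exactly the color k, not only modulo 3n.
  Meets : Point → ℕ → Set
  Meets x k = ∃[ y ] (x ≢ y × tint x y ≡ k)

  -- In its own row a vertex has no edge of color stretch (i + i); the edge to the
  -- vertex of the same index in the other row supplies it.
  lower-meets-stretch : ∀ i j → Meets (lower i) (stretch (toℕ i + toℕ j))
  lower-meets-stretch i j with i ≟ j
  ... | yes refl = upper i , (λ ()) , across-≡ i
  ... | no  i≢j  = lower j , (λ { refl → i≢j refl }) , refl

  upper-meets-stretch : ∀ i j → Meets (upper i) (stretch (toℕ i + toℕ j))
  upper-meets-stretch i j with i ≟ j
  ... | yes refl = lower i , (λ ()) , across-≡ i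
  ... | no  i≢j  = upper j , (λ { refl → i≢j refl }) , refl

  -- Both vertices of index i see i + 1, …, i + 2n - 1.
  lower-meets-arc : ∀ i {r} → suc r < 2 * n → Meets (lower i) (suc (toℕ i + r))
  lower-meets-arc i 1+r<2n with stretch-arc (toℕ<n i) 1+r<2n
  ... | inj₁ (j , eq) = subst (Meets (lower i)) eq (lower-meets-stretch i j)
  ... | inj₂ (e , 0<e , e<n , eq) with j , i≢j , rot ← rotation-target i 0<e e<n =
    upper j , (λ ()) , trans (across-≢ i≢j) (trans (cong (n +_) rot) eq)

  upper-meets-arc : ∀ i {r} → suc r < 2 * n → Meets (upper i) (suc (toℕ i + r))
  upper-meets-arc i 1+r<2n with stretch-arc (toℕ<n i) 1+r<2n
  ... | inj₁ (j , eq) = subst (Meets (upper i)) eq (upper-meets-stretch i j)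
  ... | inj₂ (e , 0<e , e<n , eq) with j , i≢j , rot ← rotation-source i 0<e e<n =
    lower j , (λ ()) , trans (across-≢ (i≢j ∘ sym)) (trans (cong (n +_) rot) eq)

  module _ {{_ : NonZero (3 * n)}} where

    arc-met : ∀ x r → r < 2 * n →
              ∃[ y ] (x ≢ y × tint x y % (3 * n) ≡ (arcStart x + r) % (3 * n))
    arc-met (lower i) zero _ = apex , (λ ()) , cong (_% (3 * n)) (sym (ℕ.+-identityʳ (toℕ i)))
    arc-met (lower i) (suc r) 1+r<2n with y , i≢y , eq ← lower-meets-arc i 1+r<2n =
      y , i≢y , cong (_% (3 * n)) (trans eq (sym (ℕ.+-suc (toℕ i) r)))
    arc-met (upper i) r r<2n with suc r ℕ.<? 2 * n
    ... | yes 1+r<2n with y , i≢y , eq ← upper-meets-arc i 1+r<2n =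
      y , i≢y , cong (_% (3 * n)) eq
    ... | no  1+r≮2n = apex , (λ ()) , cong (_% (3 * n)) (begin
        2 * n + toℕ i     ≡⟨ ℕ.+-comm (2 * n) (toℕ i) ⟩
        toℕ i + 2 * n     ≡⟨ cong (toℕ i +_) (ℕ.≤-antisym r<2n (ℕ.≮⇒≥ 1+r≮2n)) ⟨
        toℕ i + suc r     ≡⟨ ℕ.+-suc (toℕ i) r ⟩
        suc (toℕ i + r)   ∎)
      where open ≡-Reasoning
    arc-met apex r r<2n with r ℕ.<? n
    ... | yes r<n with i , refl ← fin r r<n = upper i , (λ ()) , refl
    ... | no  r≮n with o , refl ← ℕ.m≤n⇒∃[o]m+o≡n (ℕ.≮⇒≥ r≮n)
      with i , refl ← fin o (ℕ.+-cancelˡ-< n o n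
             (subst (n + o <_) (cong (n +_) (ℕ.+-identityʳ n)) r<2n)) =
      lower i , (λ ()) , (begin
        toℕ i % (3 * n)                   ≡⟨ [m+n]%n≡m%n (toℕ i) (3 * n) ⟨
        (toℕ i + 3 * n) % (3 * n)         ≡⟨ cong (_% (3 * n)) (regroup n (toℕ i)) ⟩
        (2 * n + (n + toℕ i)) % (3 * n)   ∎)
      where
      open ≡-Reasoning
      regroup : ∀ n i → i + 3 * n ≡ 2 * n + (n + i)
      regroup = solve-∀

    -- The arc of lower 0 is 0, …, 2n - 1, and the arc of the apex begins with
    -- 2n, …, 3n - 1.
    arcs-cover : 1 ≤ n → ∀ k → k < 3 * n →
                 ∃[ x ] ∃[ r ] (r < 2 * n × k ≡ (arcStart x + r) % (3 * n))
    arcs-cover 1≤n k k<3n with k ℕ.<? 2 * n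
    ... | yes k<2n with i , eq ← fin 0 1≤n =
      lower i , k , k<2n ,
      trans (sym (m<n⇒m%n≡m k<3n)) (cong (λ i → (i + k) % (3 * n)) (sym eq))
    ... | no  k≮2n with o , refl ← ℕ.m≤n⇒∃[o]m+o≡n (ℕ.≮⇒≥ k≮2n) =
      apex , o , o<2n , sym (m<n⇒m%n≡m k<3n)
      where
      3n≡2n+n : ∀ n → 3 * n ≡ 2 * n + n
      3n≡2n+n = solve-∀
      o<2n : o < 2 * n
      o<2n = ℕ.<-≤-trans (ℕ.+-cancelˡ-< (2 * n) o n (subst (2 * n + o <_) (3n≡2n+n n) k<3n))
               (ℕ.m≤m+n n (n + 0))

  odd-coloring : 1 ≤ n → IntervalCyclicColoring (complete (2 * n + 1)) (3 * n)
  odd-coloring 1≤n =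
    complete-coloring label (ℕ.+-comm (2 * n) 1) (ℕ.m≤n+m (2 * n) n)
      tint tint-sym arcStart arc-met (arcs-cover 1≤n)
    where instance
      3n≢0 : NonZero (3 * n)
      3n≢0 = >-nonZero (ℕ.<-≤-trans 1≤n (ℕ.m≤m+n n (2 * n)))

theorem27 : (n : ℕ) → 1 ≤ n → ∃[ w ] (IsWc (complete (2 * n + 1)) w × 3 * n ≤ w)
theorem27 n 1≤n = Wc-exists (complete (2 * n + 1)) (odd-coloring n 1≤n)
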